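{- There exist infinitely many pairwise non-isomorphic graphs $G$ that contain $K_{2,3}$ as a subgraph and satisfy $\Delta(G)\le 4$, $\mathrm{mad}(G)=12/5$, and $\mathrm{lc}(G)=\lceil\Delta(G)/2\rceil+2$.
   Context: Graphs are finite and simple; $\Delta(G)$ is the maximum degree. A linear coloring of $G$ is a proper vertex coloring such that the subgraph induced by the union of each pair of color classes is a linear forest, i.e. a disjoint union of paths (a single vertex counts as a path). The linear chromatic number $\mathrm{lc}(G)$ is the smallest $k$ such that $G$ has a linear coloring with $k$ colors. The maximum average degree is $\mathrm{mad}(G)=\max_{H\subseteq G}\frac{2|E(H)|}{|V(H)|}$, over all nonempty subgraphs $H$ of $G$. -}

module Defs where

open import Data.Bool.Base using (Bool; true; false; _∧_; _xor_)
open import Data.Bool.Properties using (∧-comm; xor-comm; xor-same)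
open import Data.Fin.Base using (Fin; splitAt)
open import Data.Fin.Properties using (_≟_; _<?_)
open import Data.Fin.Subset using (Subset; _∈_; _∪_; ∣_∣)
open import Data.Integer.Base using (+_)
open import Data.List.Base using (List; _∷_; _++_; map; concat; allFin)
open import Data.List.Extrema.Nat using (max)
open import Data.List.Membership.Propositional using () renaming (_∈_ to _∈ˡ_)
open import Data.List.NonEmpty.Base using (List⁺; toList)
open import Data.List.Relation.Unary.Any using (Any)
open import Data.List.Relation.Unary.Unique.Propositional using (Unique)
open import Data.Nat.Base using (ℕ; _+_; _*_; _≤_; NonZero)
open import Data.Nat.Properties using (+-0-commutativeMonoid)
open import Data.Product.Base using (Σ; ∃₂; _×_; _,_)
open import Data.Rational.Base as ℚ using (ℚ)
open import Data.Sum.Base using (_⊎_; [_,_]′)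
open import Data.Vec.Base using (tabulate; lookup)
open import Data.Vec.Properties using (lookup⇒[]=)
open import Function.Base using (const)
open import Function.Bundles using (_↔_; _⇔_; Inverse)
open import Function.Definitions using (Injective)
open import Relation.Binary.PropositionalEquality
  using (_≡_; _≢_; refl; cong₂)
open import Relation.Nullary.Decidable using (⌊_⌋)

open import Algebra.Properties.CommutativeMonoid.Sum +-0-commutativeMonoid using (sum)

record Graph : Set where
  field
    order  : ℕ
    adj    : Fin order → Fin order → Bool
    symm   : ∀ u v → adj u v ≡ adj v u
    irrefl : ∀ v → adj v v ≡ false

  Vertex : Set
  Vertex = Fin order

open Graph public

record _≅_ (G H : Graph) : Set where
  field
    bijection : Vertex G ↔ Vertex H
    preserves : ∀ u v → adj G u v ≡ adj H (Inverse.to bijection u) (Inverse.to bijection v)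

-- H is a (not necessarily induced) subgraph of G, up to isomorphism.
_ContainsSubgraph_ : Graph → Graph → Set
G ContainsSubgraph H = Σ (Vertex H → Vertex G) λ f →
  Injective _≡_ _≡_ f × (∀ u v → adj H u v ≡ true → adj G (f u) (f v) ≡ true)

completeBipartite : ℕ → ℕ → Graph
completeBipartite m n = record
  { order  = m + n
  ; adj    = λ u v → side u xor side v
  ; symm   = λ u v → xor-comm (side u) (side v)
  ; irrefl = λ v → xor-same (side v)
  }
  where
  side : Fin (m + n) → Bool
  side v = [ const true , const false ]′ (splitAt m v)

degree : (G : Graph) → Vertex G → ℕ
degree G v = ∣ tabulate (adj G v) ∣

-- The default value 0 only matters for the graph with no vertices.
maxDegree : Graph → ℕ
maxDegree G = max 0 (map (degree G) (allFin (order G)))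

record Subgraph (G : Graph) : Set where
  field
    V     : Subset (order G)
    E     : Vertex G → Vertex G → Bool
    E-sym : ∀ u v → E u v ≡ E v u
    E⊆adj : ∀ u v → E u v ≡ true → adj G u v ≡ true
    E⊆V   : ∀ u v → E u v ≡ true → u ∈ V × v ∈ V

open Subgraph public

numVertices : ∀ {G} → Subgraph G → ℕ
numVertices H = ∣ V H ∣

-- Each edge {u , v} is counted once, at its smaller endpoint.
numEdges : ∀ {G} → Subgraph G → ℕ
numEdges H = sum λ u → ∣ tabulate (λ v → ⌊ u <? v ⌋ ∧ E H u v) ∣

averageDegree : ∀ {G} (H : Subgraph G) .{{_ : NonZero (numVertices H)}} → ℚ
averageDegree H = (+ (2 * numEdges H)) ℚ./ numVertices H

-- IsMad G q says that mad(G) exists and equals q.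
IsMad : Graph → ℚ → Set
IsMad G q =
  (Σ (Subgraph G) λ H → Σ (NonZero (numVertices H)) λ nz → averageDegree H {{nz}} ≡ q) ×
  ((H : Subgraph G) .{{_ : NonZero (numVertices H)}} → averageDegree H ℚ.≤ q)

induced : (G : Graph) → Subset (order G) → Subgraph G
induced G S = record
  { V     = S
  ; E     = λ u v → (lookup S u ∧ lookup S v) ∧ adj G u v
  ; E-sym = λ u v → cong₂ _∧_ (∧-comm (lookup S u) (lookup S v)) (symm G u v)
  ; E⊆adj = λ u v e → right (lookup S u ∧ lookup S v) e
  ; E⊆V   = λ u v e → let uv = left (lookup S u ∧ lookup S v) e in
      lookup⇒[]= u S (left (lookup S u) uv) , lookup⇒[]= v S (right (lookup S u) uv)
  }
  where
  left : ∀ x {y} → x ∧ y ≡ true → x ≡ true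
  left true _ = refl

  right : ∀ x {y} → x ∧ y ≡ true → y ≡ true
  right true e = e

-- u is immediately followed by v in the list.
Consecutive : ∀ {A : Set} → A → A → List A → Set
Consecutive u v p = ∃₂ λ xs ys → p ≡ xs ++ u ∷ v ∷ ys

-- A path is given by the nonempty list of its vertices in order.  Uniqueness of
-- the concatenation says both that each path has no repeated vertex and that
-- different paths are disjoint.
IsLinearForest : ∀ {G} → Subgraph G → Set
IsLinearForest {G} H = Σ (List (List⁺ (Vertex G))) λ ps →
  let paths = map toList ps in
  Unique (concat paths) ×
  (∀ v → v ∈ V H ⇔ v ∈ˡ concat paths) ×
  (∀ u v → E H u v ≡ true ⇔ Any (λ p → Consecutive u v p ⊎ Consecutive v u p) paths)

colorClass : ∀ {n k} → (Fin n → Fin k) → Fin k → Subset n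
colorClass c a = tabulate λ v → ⌊ c v ≟ a ⌋

IsProper : ∀ {k} (G : Graph) → (Vertex G → Fin k) → Set
IsProper G c = ∀ u v → adj G u v ≡ true → c u ≢ c v

IsLinearColoring : ∀ {k} (G : Graph) → (Vertex G → Fin k) → Set
IsLinearColoring G c = IsProper G c ×
  (∀ a b → a ≢ b → IsLinearForest (induced G (colorClass c a ∪ colorClass c b)))

LinearlyColorable : Graph → ℕ → Set
LinearlyColorable G k = Σ (Vertex G → Fin k) (IsLinearColoring G)

-- IsLc G k says that lc(G) = k.
IsLc : Graph → ℕ → Set
IsLc G k = LinearlyColorable G k × (∀ j → LinearlyColorable G j → k ≤ j)

{-# OPTIONS --safe #-}

-- K₂,₃ has Δ = 3, average degree 12/5 and lc = 4, and adding isolated vertices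
-- changes none of Δ, mad and lc, so the graphs K₂,₃ + i K₁ form the family.
--
-- lc(K₂,₃) ≥ 4: in a linear forest laid out along a line, two distinct
-- neighbours of a vertex have it as their midpoint, so no vertex has three
-- neighbours and no two vertices have two common neighbours.  If the two
-- vertices of the small side have the same colour, the other three must then
-- get distinct colours; otherwise those three cannot all be coloured alike.
module Submission where

open import Defs
open import Data.Nat.Base using (ℕ; _+_; _≤_; ⌈_/2⌉)
open import Data.Integer.Base using (+_)
open import Data.Rational.Base using (_/_)
open import Data.Product.Base using (Σ; _×_)
open import Relation.Nullary.Negation.Core using (¬_)
open import Relation.Binary.PropositionalEquality using (_≢_)

open import Data.Bool.Base using (Bool; true; false; _∧_; _∨_)
import Data.Bool.Properties as Bool
open import Data.Fin.Base using (Fin; zero; suc)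
open import Data.Fin.Patterns using (0F; 1F; 2F; 3F; 4F)
open import Data.Fin.Permutation using (↔⇒≡)
import Data.Fin.Properties as Fin
open import Data.Fin.Subset using (Subset; _∈_; _∪_; ∣_∣; inside; outside; ⊤)
open import Data.Fin.Subset.Properties
  using (anySubset?; p⊆q⇒∣p∣≤∣q∣; x∈p∪q⁺; _∈?_; drop-there)
open import Data.Integer.Base as ℤ using (+≤+)
import Data.Integer.Properties as ℤ
open import Data.List.Base using (List; []; _∷_; [_]; _++_; map; concat; lookup; tabulate; allFin)
open import Data.List.Extrema.Nat using (max; max≤v⁺; xs≤max; max-mono-⊆)
open import Data.List.NonEmpty.Base using (List⁺; _∷_; toList) renaming (map to map⁺)
open import Data.List.Properties using (map-++; ++-assoc; ∷-injectiveʳ; map-∘; map-tabulate; concat-map)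
open import Data.List.Membership.Propositional using () renaming (_∈_ to _∈ˡ_)
open import Data.List.Membership.Propositional.Properties using (∈-map⁺; ∈-map⁻; ∈-lookup)
open import Data.List.Relation.Unary.All as All using ([]; _∷_)
import Data.List.Relation.Unary.All.Properties as All
open import Data.List.Relation.Unary.AllPairs using ([]; _∷_)
open import Data.List.Relation.Unary.Any as Any using (Any; here; there)
import Data.List.Relation.Unary.Any.Properties as Any
open import Data.List.Relation.Unary.Unique.Propositional using (Unique)
import Data.List.Relation.Unary.Unique.Propositional.Properties as Unique
open import Data.Nat.Base using (zero; suc; _*_; NonZero; z≤n)
import Data.Nat.Properties as ℕ
open import Data.Product.Base using (∃₂; _,_; proj₁; proj₂)
open import Data.Rational.Base as ℚ using (ℚ)
import Data.Rational.Properties as ℚ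
open import Data.Rational.Unnormalised.Base using (mkℚᵘ; *≤*)
import Data.Rational.Unnormalised.Properties as ℚᵘ
open import Data.Sum.Base as Sum using (_⊎_; inj₁; inj₂)
import Data.Vec.Base as Vec
open import Data.Vec.Base using (here; there)
open import Data.Vec.Properties using (lookup∘tabulate; lookup⇒[]=; []=⇒lookup; tabulate-cong)
open import Function.Base using (_∘_; id)
open import Function.Bundles using (_⇔_; mk⇔; Equivalence)
open import Function.Definitions using (Injective)
open import Relation.Binary.Definitions using (DecidableEquality)
open import Relation.Binary.PropositionalEquality
  using (_≡_; refl; sym; trans; cong; cong₂; subst; module ≡-Reasoning)
open import Relation.Nullary.Decidable
  using (Dec; yes; no; ⌊_⌋; map′; _×-dec_; _⊎-dec_; _→-dec_; ¬?; dec-true; isYes≗does;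
         toWitness; toWitnessFalse; decidable-stable; True)
open import Relation.Nullary.Negation.Core using (contradiction)
open import Algebra.Properties.CommutativeMonoid.Sum ℕ.+-0-commutativeMonoid
  using (sum; sum-cong-≗)

open Equivalence using (to; from)

-- Numbers of edges

∣tabulate-false∣ : ∀ {n} {f : Fin n → Bool} → (∀ v → f v ≡ false) → ∣ Vec.tabulate f ∣ ≡ 0
∣tabulate-false∣ {zero}  f≡false = refl
∣tabulate-false∣ {suc n} {f} f≡false with f zero | f≡false zero
... | false | refl = ∣tabulate-false∣ (f≡false ∘ suc)

∈-tabulate⁻ : ∀ {n} (f : Fin n → Bool) {v} → v ∈ Vec.tabulate f → f v ≡ true
∈-tabulate⁻ f {v} v∈ = trans (sym (lookup∘tabulate f v)) ([]=⇒lookup v∈)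

∈-tabulate⁺ : ∀ {n} (f : Fin n → Bool) {v} → f v ≡ true → v ∈ Vec.tabulate f
∈-tabulate⁺ f {v} fv = lookup⇒[]= v _ (trans (lookup∘tabulate f v) fv)

sum-mono-≤ : ∀ {n} {f g : Fin n → ℕ} → (∀ i → f i ≤ g i) → sum f ≤ sum g
sum-mono-≤ {zero}  f≤g = z≤n
sum-mono-≤ {suc n} f≤g = ℕ.+-mono-≤ (f≤g zero) (sum-mono-≤ (f≤g ∘ suc))

∧-monoʳ : ∀ x {y z} → (y ≡ true → z ≡ true) → x ∧ y ≡ true → x ∧ z ≡ true
∧-monoʳ true y⇒z = y⇒z

∧-falseʳ : ∀ x {y} → y ≡ false → x ∧ y ≡ false
∧-falseʳ true  refl = refl
∧-falseʳ false refl = refl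

-- Every edge of `H` joins two vertices of `V H`, so it survives in the induced subgraph. A density
-- bound therefore has to be checked on one subgraph per vertex set only.
numEdges≤induced : ∀ {G} (H : Subgraph G) → numEdges H ≤ numEdges (induced G (V H))
numEdges≤induced {G} H = sum-mono-≤ λ u → p⊆q⇒∣p∣≤∣q∣ λ {v} v∈ →
  ∈-tabulate⁺ _ (∧-monoʳ ⌊ u Fin.<? v ⌋ (E⇒induced u v) (∈-tabulate⁻ _ v∈))
  where
  E⇒induced : ∀ u v → E H u v ≡ true → E (induced G (V H)) u v ≡ true
  E⇒induced u v e with u∈ , v∈ ← E⊆V H u v e
    rewrite []=⇒lookup u∈ | []=⇒lookup v∈ = E⊆adj H u v e

-- Adding an isolated vertex

addIsolated : Graph → Graph
addIsolated G = record
  { order  = suc (order G)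
  ; adj    = adj′
  ; symm   = λ { zero zero → refl ; zero (suc v) → refl ; (suc u) zero → refl ; (suc u) (suc v) → symm G u v }
  ; irrefl = λ { zero → refl ; (suc v) → irrefl G v }
  }
  where
  adj′ : Fin (suc (order G)) → Fin (suc (order G)) → Bool
  adj′ (suc u) (suc v) = adj G u v
  adj′ _       _       = false

contains-addIsolated : ∀ {G K} → G ContainsSubgraph K → addIsolated G ContainsSubgraph K
contains-addIsolated (f , f-inj , f-adj) = suc ∘ f , f-inj ∘ Fin.suc-injective , f-adj

max-0∷ : ∀ xs → max 0 (0 ∷ xs) ≡ max 0 xs
max-0∷ xs = ℕ.≤-antisym (max≤v⁺ {xs = 0 ∷ xs} z≤n (z≤n ∷ xs≤max 0 xs)) (max-mono-⊆ {xs = xs} {0 ∷ xs} z≤n there)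

maxDegree-addIsolated : ∀ G → maxDegree (addIsolated G) ≡ maxDegree G
maxDegree-addIsolated G = begin
  max 0 (degree G⁺ zero ∷ map (degree G⁺) (tabulate suc)) ≡⟨ cong₂ (λ d ds → max 0 (d ∷ ds)) (∣tabulate-false∣ isolated) degrees ⟩
  max 0 (0 ∷ map (degree G) (allFin (order G)))           ≡⟨ max-0∷ (map (degree G) (allFin (order G))) ⟩
  max 0 (map (degree G) (allFin (order G)))               ∎
  where
  open ≡-Reasoning
  G⁺ = addIsolated G

  isolated : ∀ v → adj G⁺ zero v ≡ false
  isolated zero    = refl
  isolated (suc v) = refl

  degrees : map (degree G⁺) (tabulate suc) ≡ map (degree G) (allFin (order G))
  degrees = trans (map-tabulate suc (degree G⁺)) (sym (map-tabulate id (degree G)))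

restrict : ∀ {G} → Subgraph (addIsolated G) → Subgraph G
restrict H = record
  { V     = Vec.tail (V H)
  ; E     = λ u v → E H (suc u) (suc v)
  ; E-sym = λ u v → E-sym H (suc u) (suc v)
  ; E⊆adj = λ u v → E⊆adj H (suc u) (suc v)
  ; E⊆V   = λ u v e → drop (V H) (proj₁ (E⊆V H (suc u) (suc v) e)) , drop (V H) (proj₂ (E⊆V H (suc u) (suc v) e))
  }
  where
  drop : ∀ {n} (p : Subset (suc n)) {v} → suc v ∈ p → v ∈ Vec.tail p
  drop (_ Vec.∷ _) = drop-there

-- The row of the isolated vertex counts nothing. In a row `suc u` the column `zero` drops out by
-- computation, because edges are counted at their smaller endpoint.
numEdges-restrict : ∀ {G} (H : Subgraph (addIsolated G)) → numEdges H ≡ numEdges (restrict H)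
numEdges-restrict {G} H = cong₂ _+_
  (∣tabulate-false∣ λ v → ∧-falseʳ ⌊ zero {n = order G} Fin.<? v ⌋ (E-zero v))
  (sum-cong-≗ {order G} λ u → cong ∣_∣ (tabulate-cong λ v → cong (_∧ E H (suc u) (suc v)) (<?-suc u v)))
  where
  E-zero : ∀ v → E H zero v ≡ false
  E-zero v = Bool.¬-not λ e → contradiction {A = false ≡ true} (E⊆adj H zero v e) λ ()

  <?-suc : ∀ {n} (u v : Fin n) → ⌊ suc u Fin.<? suc v ⌋ ≡ ⌊ u Fin.<? v ⌋
  -- The two decisions have the same `does` by computation.
  <?-suc u v = trans (isYes≗does (suc u Fin.<? suc v)) (sym (isYes≗does (u Fin.<? v)))

-- The bound `a / b` on all average degrees, with denominators cleared. In this form it also makes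
-- sense for the empty subgraph, which can arise when the isolated vertex is deleted, and it can be
-- decided by evaluation.
DensityAtMost : ℕ → ℕ → Graph → Set
DensityAtMost a b G = (H : Subgraph G) → b * (2 * numEdges H) ≤ a * numVertices H

densityAtMost-addIsolated : ∀ {a b G} → DensityAtMost a b G → DensityAtMost a b (addIsolated G)
densityAtMost-addIsolated {a} {b} dense H = begin
  b * (2 * numEdges H)            ≡⟨ cong (λ e → b * (2 * e)) (numEdges-restrict H) ⟩
  b * (2 * numEdges (restrict H)) ≤⟨ dense (restrict H) ⟩
  a * numVertices (restrict H)    ≤⟨ ℕ.*-monoʳ-≤ a (∣tail∣≤ (V H)) ⟩
  a * numVertices H               ∎
  where
  open ℕ.≤-Reasoning
  ∣tail∣≤ : ∀ {n} (p : Subset (suc n)) → ∣ Vec.tail p ∣ ≤ ∣ p ∣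
  ∣tail∣≤ (false Vec.∷ p) = ℕ.≤-refl
  ∣tail∣≤ (true  Vec.∷ p) = ℕ.n≤1+n _

-- The quotients in `ℚ` are reduced to lowest terms; passing to unnormalised rationals turns the
-- comparison into cross multiplication.
/-mono-≤ : ∀ m n a b .{{_ : NonZero n}} .{{_ : NonZero b}} → b * m ≤ a * n → + m / n ℚ.≤ + a / b
/-mono-≤ m n@(suc n-1) a b@(suc b-1) bm≤an = ℚ.toℚᵘ-cancel-≤
  (ℚᵘ.≤-respˡ-≃ (ℚᵘ.≃-sym (ℚ.toℚᵘ-fromℚᵘ (mkℚᵘ (+ m) n-1)))
    (ℚᵘ.≤-respʳ-≃ (ℚᵘ.≃-sym (ℚ.toℚᵘ-fromℚᵘ (mkℚᵘ (+ a) b-1))) (*≤* cross)))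
  where
  open ℤ.≤-Reasoning
  cross : + m ℤ.* + b ℤ.≤ + a ℤ.* + n
  cross = begin
    + m ℤ.* + b ≡⟨ ℤ.pos-* m b ⟨
    + (m * b)   ≤⟨ +≤+ (subst (_≤ a * n) (ℕ.*-comm b m) bm≤an) ⟩
    + (a * n)   ≡⟨ ℤ.pos-* a n ⟩
    + a ℤ.* + n ∎

HasAverageDegree : Graph → ℚ → Set
HasAverageDegree G q = Σ (Subgraph G) λ H → Σ (NonZero (numVertices H)) λ nz → averageDegree H {{nz}} ≡ q

-- The witness leaves out the new vertex, so its numbers of vertices and edges stay the same.
hasAverageDegree-addIsolated : ∀ {G q} → HasAverageDegree G q → HasAverageDegree (addIsolated G) q
hasAverageDegree-addIsolated {G} (H , nz , avg) =
  H⁺ , nz , trans (cong (λ e → (+ (2 * e) / numVertices H) {{nz}}) (numEdges-restrict H⁺)) avg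
  where
  E⁺ : Fin (suc (order G)) → Fin (suc (order G)) → Bool
  E⁺ (suc u) (suc v) = E H u v
  E⁺ _       _       = false

  H⁺ : Subgraph (addIsolated G)
  H⁺ = record
    { V     = outside Vec.∷ V H
    ; E     = E⁺
    ; E-sym = λ { zero zero → refl ; zero (suc v) → refl ; (suc u) zero → refl ; (suc u) (suc v) → E-sym H u v }
    ; E⊆adj = λ { (suc u) (suc v) → E⊆adj H u v ; zero zero () ; zero (suc v) () ; (suc u) zero () }
    ; E⊆V   = λ { (suc u) (suc v) e → let u∈ , v∈ = E⊆V H u v e in there u∈ , there v∈
                ; zero zero () ; zero (suc v) () ; (suc u) zero () }
    }

isMad : ∀ {G} a b .{{_ : NonZero b}} → HasAverageDegree G (+ a / b) → DensityAtMost a b G → IsMad G (+ a / b)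
isMad a b attained dense = attained , λ H → /-mono-≤ (2 * numEdges H) (numVertices H) a b (dense H)

-- Linear forests

Neighbours : ∀ {A : Set} → A → A → List A → Set
Neighbours u v p = Consecutive u v p ⊎ Consecutive v u p

-- The condition that `IsLinearForest` puts on its paths, stated for plain lists so that paths can
-- be mapped and extended without carrying nonemptiness along.
Decomposes : ∀ {G} → Subgraph G → List (List (Vertex G)) → Set
Decomposes H paths =
  Unique (concat paths) ×
  (∀ v → v ∈ V H ⇔ v ∈ˡ concat paths) ×
  (∀ u v → E H u v ≡ true ⇔ Any (λ p → Neighbours u v p) paths)

consecutive-map⁺ : ∀ {A B : Set} (f : A → B) {u v p} → Consecutive u v p → Consecutive (f u) (f v) (map f p)
consecutive-map⁺ f {u} {v} (xs , ys , refl) = map f xs , map f ys , map-++ f xs (u ∷ v ∷ ys)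

consecutive-map⁻ : ∀ {A B : Set} (f : A → B) {u v} p → Consecutive u v (map f p) →
                   ∃₂ λ a b → u ≡ f a × v ≡ f b × Consecutive a b p
consecutive-map⁻ f (x ∷ y ∷ p) ([]     , ys , refl) = x , y , refl , refl , [] , p , refl
consecutive-map⁻ f (x ∷ p)     (_ ∷ xs , ys , eq)
  with a , b , u≡ , v≡ , xs′ , ys′ , eq′ ← consecutive-map⁻ f p (xs , ys , ∷-injectiveʳ eq)
  = a , b , u≡ , v≡ , x ∷ xs′ , ys′ , cong (x ∷_) eq′
consecutive-map⁻ f (x ∷ [])    ([]     , ys , ())
consecutive-map⁻ f []          ([]     , ys , ())
consecutive-map⁻ f []          (_ ∷ _  , ys , ())

neighbours-map⁺ : ∀ {A B : Set} (f : A → B) {u v p} → Neighbours u v p → Neighbours (f u) (f v) (map f p)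
neighbours-map⁺ f = Sum.map (consecutive-map⁺ f) (consecutive-map⁺ f)

neighbours-map⁻ : ∀ {A B : Set} (f : A → B) {u v} p → Neighbours u v (map f p) →
                  ∃₂ λ a b → u ≡ f a × v ≡ f b × Neighbours a b p
neighbours-map⁻ f p (inj₁ c) with a , b , u≡ , v≡ , c′ ← consecutive-map⁻ f p c = a , b , u≡ , v≡ , inj₁ c′
neighbours-map⁻ f p (inj₂ c) with b , a , v≡ , u≡ , c′ ← consecutive-map⁻ f p c = a , b , u≡ , v≡ , inj₂ c′

-- This allows all paths to be laid end to end on one line. The converse fails where one path ends
-- and the next begins.
consecutive-concat : ∀ {A : Set} {u v : A} {pss} → Any (Consecutive u v) pss → Consecutive u v (concat pss)
consecutive-concat {u = u} {v} {_ ∷ pss} (here (xs , ys , refl)) =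
  xs , ys ++ concat pss , ++-assoc xs (u ∷ v ∷ ys) (concat pss)
consecutive-concat {pss = p ∷ pss} (there consec) with xs , ys , eq ← consecutive-concat consec
  = p ++ xs , ys , trans (cong (p ++_) eq) (sym (++-assoc p xs _))

¬consecutive-[x] : ∀ {A : Set} {u v x : A} → ¬ Consecutive u v [ x ]
¬consecutive-[x] ([]         , ys , ())
¬consecutive-[x] (_ ∷ []     , ys , ())
¬consecutive-[x] (_ ∷ _ ∷ xs , ys , ())

¬neighbours-[x] : ∀ {A : Set} {u v x : A} → ¬ Neighbours u v [ x ]
¬neighbours-[x] = Sum.[ ¬consecutive-[x] , ¬consecutive-[x] ]

-- The old paths are renamed along `suc`. Injectivity of `suc` keeps them disjoint, and `zero` is
-- neither in the vertex set nor on a renamed path.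
decomposes-outside : ∀ {G S pss} → Decomposes (induced G S) pss →
                     Decomposes (induced (addIsolated G) (outside Vec.∷ S)) (map (map suc) pss)
decomposes-outside {G} {S} {pss} (unique , vertices , edges)
  = unique′ , vertices′ , edges′
  where
  H = induced (addIsolated G) (outside Vec.∷ S)

  shifted : List (List (Vertex (addIsolated G)))
  shifted = map (map suc) pss

  concat-shifted : concat shifted ≡ map suc (concat pss)
  concat-shifted = concat-map pss

  unique′ : Unique (concat shifted)
  unique′ rewrite concat-shifted = Unique.map⁺ Fin.suc-injective unique

  vertices′ : ∀ v → v ∈ V H ⇔ v ∈ˡ concat shifted
  vertices′ v rewrite concat-shifted = mk⇔ (⇒ v) ⇐
    where
    ⇒ : ∀ v → v ∈ V H → v ∈ˡ map suc (concat pss)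
    ⇒ (suc v) (there v∈S) = ∈-map⁺ suc (to (vertices v) v∈S)

    ⇐ : v ∈ˡ map suc (concat pss) → v ∈ V H
    ⇐ v∈ with w , w∈ , refl ← ∈-map⁻ suc v∈ = there (from (vertices w) w∈)

  edges′ : ∀ u v → E H u v ≡ true ⇔ Any (Neighbours u v) shifted
  edges′ u v = mk⇔ (⇒ u v) (⇐ u v)
    where
    ⇒ : ∀ u v → E H u v ≡ true → Any (Neighbours u v) shifted
    ⇒ (suc u) (suc v) e = Any.map⁺ (Any.map (neighbours-map⁺ suc) (to (edges u v) e))
    -- This edge indicator is stuck on `lookup S u`, whereas one with first endpoint `zero` computes
    -- to `false`.
    ⇒ (suc u) zero    e = contradiction (trans (sym e) (∧-falseʳ (Vec.lookup S u ∧ false) refl)) λ ()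

    ⇐ : ∀ u v → Any (Neighbours u v) shifted → E H u v ≡ true
    ⇐ (suc u) (suc v) c = from (edges u v) (Any.map (λ {p} → reflect p) (Any.map⁻ c))
      where
      reflect : ∀ p → Neighbours (suc u) (suc v) (map suc p) → Neighbours u v p
      reflect p n with _ , _ , refl , refl , n′ ← neighbours-map⁻ suc p n = n′
    ⇐ zero    v    c with p , n ← Any.satisfied (Any.map⁻ c) with _ , _ , () , _ ← neighbours-map⁻ suc p n
    ⇐ (suc u) zero c with p , n ← Any.satisfied (Any.map⁻ c) with _ , _ , _ , () , _ ← neighbours-map⁻ suc p n

-- The isolated vertex becomes a path of its own. The given paths avoid it, since they cover exactly
-- a set that omits it, and it brings no edges.
decomposes-inside : ∀ {G S pss} → Decomposes (induced (addIsolated G) (outside Vec.∷ S)) pss →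
                    Decomposes (induced (addIsolated G) (inside Vec.∷ S)) ([ zero ] ∷ pss)
decomposes-inside {G} {S} {pss} (unique , vertices , edges)
  = All.tabulate (λ { v∈ refl → zero∉ (from (vertices zero) v∈) }) ∷ unique
  , (λ v → mk⇔ (⇒ v) (⇐ v))
  , λ u v → mk⇔ (there ∘ to (edges u v) ∘ trans (E-outside u v))
                λ { (here n) → contradiction n ¬neighbours-[x]
                  ; (there c) → trans (sym (E-outside u v)) (from (edges u v) c) }
  where
  G⁺ = addIsolated G

  zero∉ : ¬ zero ∈ outside Vec.∷ S
  zero∉ ()

  ⇒ : ∀ v → v ∈ inside Vec.∷ S → v ∈ˡ zero ∷ concat pss
  ⇒ zero    _         = here refl
  ⇒ (suc v) (there v∈S) = there (to (vertices (suc v)) (there v∈S))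

  ⇐ : ∀ v → v ∈ˡ zero ∷ concat pss → v ∈ inside Vec.∷ S
  ⇐ v (here refl) = here
  ⇐ v (there v∈) with there v∈S ← from (vertices v) v∈ = there v∈S

  E-outside : ∀ u v → E (induced G⁺ (outside Vec.∷ S)) u v ≡ E (induced G⁺ (inside Vec.∷ S)) u v
  E-outside zero    zero    = refl
  E-outside zero    (suc v) = sym (∧-falseʳ (Vec.lookup S v) refl)
  E-outside (suc u) zero    = trans (∧-falseʳ (Vec.lookup S u ∧ false) refl) (sym (∧-falseʳ (Vec.lookup S u ∧ true) refl))
  E-outside (suc u) (suc v) = refl

isLinearForest-addIsolated : ∀ {G S} s → IsLinearForest (induced G S) →
                             IsLinearForest (induced (addIsolated G) (s Vec.∷ S))
isLinearForest-addIsolated {G} {S} s (ps , decomposes) = extend s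
  where
  shifted : Decomposes (induced (addIsolated G) (outside Vec.∷ S)) (map toList (map (map⁺ suc) ps))
  -- On a single path, `map suc ∘ toList` and `toList ∘ map⁺ suc` agree by computation; the two uses
  -- of `map-∘` carry this over to the list of paths.
  shifted = subst (Decomposes (induced (addIsolated G) (outside Vec.∷ S))) (trans (sym (map-∘ ps)) (map-∘ ps))
    (decomposes-outside {G} {S} decomposes)

  extend : ∀ s → IsLinearForest (induced (addIsolated G) (s Vec.∷ S))
  extend false = map (map⁺ suc) ps , shifted
  extend true  = (zero ∷ []) ∷ map (map⁺ suc) ps , decomposes-inside {G} {S} shifted

-- An isolated vertex may receive any color, and `suc k` ensures that there is one.
linearlyColorable-addIsolated : ∀ {G k} → LinearlyColorable G (suc k) → LinearlyColorable (addIsolated G) (suc k)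
linearlyColorable-addIsolated {G} {k} (c , proper , forest) = c⁺ , proper⁺ , forest⁺
  where
  c⁺ : Fin (suc (order G)) → Fin (suc k)
  c⁺ zero    = zero
  c⁺ (suc v) = c v

  proper⁺ : IsProper (addIsolated G) c⁺
  proper⁺ (suc u) (suc v) = proper u v
  proper⁺ zero    zero    ()
  proper⁺ zero    (suc v) ()
  proper⁺ (suc u) zero    ()

  forest⁺ : ∀ a b → a ≢ b → IsLinearForest (induced (addIsolated G) (colorClass c⁺ a ∪ colorClass c⁺ b))
  -- The Boolean says whether the new vertex, of color `zero`, lies in one of the two classes. The
  -- rest of their union is the old union by computation.
  forest⁺ a b a≢b = isLinearForest-addIsolated (⌊ zero Fin.≟ a ⌋ ∨ ⌊ zero Fin.≟ b ⌋) (forest a b a≢b)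

-- Positions in a linear forest

module _ {A : Set} (_≟_ : DecidableEquality A) where

  -- A value that does not occur gets the length of the list, so positions separate members only.
  position : A → List A → ℕ
  position v []       = 0
  position v (x ∷ xs) with v ≟ x
  ... | yes _ = 0
  ... | no  _ = suc (position v xs)

  position-injective : ∀ {u v} xs → u ∈ˡ xs → v ∈ˡ xs → position u xs ≡ position v xs → u ≡ v
  position-injective {u} {v} (x ∷ xs) u∈ v∈ eq with u ≟ x | v ≟ x
  ... | yes u≡x | yes v≡x = trans u≡x (sym v≡x)
  ... | no  u≢x | no  v≢x = position-injective xs (Any.tail u≢x u∈) (Any.tail v≢x v∈) (ℕ.suc-injective eq)

  position-here : ∀ v xs → position v (v ∷ xs) ≡ 0
  position-here v xs with v ≟ v
  ... | yes _   = refl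
  ... | no  v≢v = contradiction refl v≢v

  position-there : ∀ {v x} xs → x ≢ v → position v (x ∷ xs) ≡ suc (position v xs)
  position-there {v} {x} xs x≢v with v ≟ x
  ... | yes v≡x = contradiction (sym v≡x) x≢v
  ... | no  _   = refl

  -- Without repetitions the first occurrence, which `position` finds, is the only one. An entry in
  -- front of `u` and `v` differs from both and shifts both positions by one.
  position-consecutive : ∀ {u v xs} → Unique xs → Consecutive u v xs → position v xs ≡ suc (position u xs)
  position-consecutive {u} {v} ((u≢v ∷ _) ∷ _) ([] , ys , refl)
    rewrite position-there (v ∷ ys) u≢v | position-here u (v ∷ ys) | position-here v ys = refl
  position-consecutive {u} {v} (x∉ ∷ unique) (x ∷ xs , ys , refl)
    rewrite position-there (xs ++ u ∷ v ∷ ys) (All.head (All.++⁻ʳ xs x∉))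
          | position-there (xs ++ u ∷ v ∷ ys) (All.head (All.tail (All.++⁻ʳ xs x∉)))
    = cong suc (position-consecutive unique (xs , ys , refl))

Adjacent : ℕ → ℕ → Set
Adjacent m n = suc m ≡ n ⊎ suc n ≡ m

-- Distinct numbers adjacent to `m` lie on opposite sides of it. The sum expresses this
-- symmetrically and without subtraction.
adjacent-midpoint : ∀ {m x y} → Adjacent m x → Adjacent m y → x ≢ y → x + y ≡ m + m
adjacent-midpoint         (inj₁ refl) (inj₁ refl) x≢y = contradiction refl x≢y
adjacent-midpoint {y = y} (inj₁ refl) (inj₂ refl) x≢y = cong suc (sym (ℕ.+-suc y y))
adjacent-midpoint {x = x} (inj₂ refl) (inj₁ refl) x≢y = ℕ.+-suc x (suc x)
adjacent-midpoint         (inj₂ refl) (inj₂ refl) x≢y = contradiction refl x≢y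

m+m-injective : ∀ m n → m + m ≡ n + n → m ≡ n
m+m-injective zero    zero    eq = refl
m+m-injective (suc m) (suc n) eq = cong suc (m+m-injective m n
  (ℕ.suc-injective (trans (sym (ℕ.+-suc m m)) (trans (ℕ.suc-injective eq) (ℕ.+-suc n n)))))

module _ {G} {H : Subgraph G} (forest : IsLinearForest H) where

  private
    paths : List (List (Vertex G))
    paths = map toList (proj₁ forest)

    decomposes : Decomposes H paths
    decomposes = proj₂ forest

    pos : Vertex G → ℕ
    pos v = position Fin._≟_ v (concat paths)

    consecutive-pos : ∀ {u v} → Any (Consecutive u v) paths → suc (pos u) ≡ pos v
    consecutive-pos c = sym (position-consecutive Fin._≟_ (proj₁ decomposes) (consecutive-concat c))

    edge-pos : ∀ {u v} → E H u v ≡ true → Adjacent (pos u) (pos v)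
    edge-pos {u} {v} e = Sum.map consecutive-pos consecutive-pos
      (Any.Any-⊎⁻ (to (proj₂ (proj₂ decomposes) u v) e))

    pos-injective : ∀ {u v} → u ∈ V H → v ∈ V H → pos u ≡ pos v → u ≡ v
    pos-injective {u} {v} u∈ v∈ = position-injective Fin._≟_ (concat paths)
      (to (proj₁ (proj₂ decomposes) u) u∈) (to (proj₁ (proj₂ decomposes) v) v∈)

    midpoint : ∀ {m x y} → E H m x ≡ true → E H m y ≡ true → x ≢ y → pos x + pos y ≡ pos m + pos m
    midpoint {m} {x} {y} mx my x≢y = adjacent-midpoint (edge-pos mx) (edge-pos my)
      (x≢y ∘ pos-injective (proj₂ (E⊆V H m x mx)) (proj₂ (E⊆V H m y my)))

  -- `m` is the midpoint of `x` and `y` and also of `x` and `z`; cancelling the position of `x`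
  -- identifies `y` with `z`.
  linearForest-degree≤2 : ∀ {m x y z} → E H m x ≡ true → E H m y ≡ true → E H m z ≡ true →
                          x ≢ y → x ≢ z → y ≡ z
  linearForest-degree≤2 {m} {x} {y} {z} mx my mz x≢y x≢z =
    pos-injective (proj₂ (E⊆V H m y my)) (proj₂ (E⊆V H m z mz))
      (ℕ.+-cancelˡ-≡ (pos x) _ _ (trans (midpoint mx my x≢y) (sym (midpoint mx mz x≢z))))

  -- Both `a` and `b` sit at the midpoint of `x` and `y`.
  linearForest-no-C₄ : ∀ {a b x y} → E H a x ≡ true → E H a y ≡ true → E H b x ≡ true → E H b y ≡ true →
                       x ≢ y → a ≡ b
  linearForest-no-C₄ {a} {b} {x} ax ay bx by x≢y =
    pos-injective (proj₁ (E⊆V H a x ax)) (proj₁ (E⊆V H b x bx))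
      (m+m-injective _ _ (trans (sym (midpoint ax ay x≢y)) (midpoint bx by x≢y)))

-- Constraints on linear colorings and the lower bound for `K₂,₃`

∈-colorClass : ∀ {n k} (c : Fin n → Fin k) v → v ∈ colorClass c (c v)
∈-colorClass c v = ∈-tabulate⁺ _ (trans (isYes≗does (c v Fin.≟ c v)) (dec-true (c v Fin.≟ c v) refl))

module _ {G k} {c : Vertex G → Fin k} (linear : IsLinearColoring G c) where

  private
    bicolored : Fin k → Fin k → Subgraph G
    bicolored a b = induced G (colorClass c a ∪ colorClass c b)

    -- The colors enter through equations so that edges with different endpoints can be placed in
    -- one and the same subgraph.
    bicolored-edge : ∀ {u v a b} → adj G u v ≡ true → c u ≡ a → c v ≡ b → E (bicolored a b) u v ≡ true
    bicolored-edge {u} {v} uv refl refl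
      rewrite []=⇒lookup (x∈p∪q⁺ {p = colorClass c (c u)} {colorClass c (c v)} (inj₁ (∈-colorClass c u)))
            | []=⇒lookup (x∈p∪q⁺ {p = colorClass c (c u)} {colorClass c (c v)} (inj₂ (∈-colorClass c v))) = uv

  -- Otherwise `m` would have three neighbours in the linear forest on the colors of `m` and `x`,
  -- which differ because the coloring is proper.
  no-monochromatic-triple : ∀ {m x y z} → adj G m x ≡ true → adj G m y ≡ true → adj G m z ≡ true →
                            x ≢ y → x ≢ z → y ≢ z → c x ≡ c y → c x ≢ c z
  no-monochromatic-triple {m} {x} mx my mz x≢y x≢z y≢z xy xz = y≢z
    (linearForest-degree≤2 {H = bicolored (c m) (c x)} (proj₂ linear (c m) (c x) (proj₁ linear m x mx))
      (bicolored-edge mx refl refl) (bicolored-edge my refl (sym xy)) (bicolored-edge mz refl (sym xz)) x≢y x≢z)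

  -- Otherwise the four vertices would form a 4-cycle in the linear forest on the colors of `a` and
  -- `x`.
  no-bicolored-C₄ : ∀ {a b x y} → adj G a x ≡ true → adj G a y ≡ true → adj G b x ≡ true → adj G b y ≡ true →
                    a ≢ b → x ≢ y → c a ≡ c b → c x ≢ c y
  no-bicolored-C₄ {a} {b} {x} ax ay bx by a≢b x≢y ab xy = a≢b
    (linearForest-no-C₄ {H = bicolored (c a) (c x)} (proj₂ linear (c a) (c x) (proj₁ linear a x ax))
      (bicolored-edge ax refl refl) (bicolored-edge ay refl (sym xy))
      (bicolored-edge bx (sym ab) refl) (bicolored-edge by (sym ab) (sym xy)) x≢y)

lookup-injective : ∀ {A : Set} {xs : List A} → Unique xs → Injective _≡_ _≡_ (lookup xs)
lookup-injective (x∉ ∷ unique) {zero}  {zero}  eq = refl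
lookup-injective (x∉ ∷ unique) {zero}  {suc j} eq = contradiction eq (All.lookup x∉ (∈-lookup j))
lookup-injective (x∉ ∷ unique) {suc i} {zero}  eq = contradiction (sym eq) (All.lookup x∉ (∈-lookup i))
lookup-injective (x∉ ∷ unique) {suc i} {suc j} eq = cong suc (lookup-injective unique eq)

-- Listing the four colors gives an injection of `Fin 4` into `Fin k`.
four-distinct⇒4≤ : ∀ {k} {p q r s : Fin k} → p ≢ q → p ≢ r → p ≢ s → q ≢ r → q ≢ s → r ≢ s → 4 ≤ k
four-distinct⇒4≤ pq pr ps qr qs rs = Fin.injective⇒≤ (lookup-injective
  ((pq ∷ pr ∷ ps ∷ []) ∷ (qr ∷ qs ∷ []) ∷ (rs ∷ []) ∷ [] ∷ []))

K₂,₃ : Graph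
K₂,₃ = completeBipartite 2 3

contains-K₂,₃⇒4≤lc : ∀ {G k} → G ContainsSubgraph K₂,₃ → LinearlyColorable G k → 4 ≤ k
contains-K₂,₃⇒4≤lc {G} {k} (f , f-inj , f-adj) (c , linear@(proper , _)) = bound (κ 0F Fin.≟ κ 1F)
  where
  κ : Vertex K₂,₃ → Fin k
  κ = c ∘ f

  -- The small side is `0F`, `1F` and the large side `2F`, `3F`, `4F`. For concrete vertices the
  -- implicit argument is found by evaluating `adj`.
  edge : ∀ u v {e : True (adj K₂,₃ u v Bool.≟ true)} → adj G (f u) (f v) ≡ true
  edge u v {e} = f-adj u v (toWitness e)

  apart : ∀ u v {e : True (adj K₂,₃ u v Bool.≟ true)} → κ u ≢ κ v
  apart u v {e} = proper (f u) (f v) (edge u v {e})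

  distinct : ∀ {u v} → u ≢ v → f u ≢ f v
  distinct u≢v = u≢v ∘ f-inj

  bound : Dec (κ 0F ≡ κ 1F) → 4 ≤ k
  -- The four colors are those of `0F` and of the whole large side: two equal ones there would give
  -- a two-colored 4-cycle through `0F` and `1F`.
  bound (yes 0≡1) = four-distinct⇒4≤ (apart 0F 2F) (apart 0F 3F) (apart 0F 4F)
    (no-bicolored-C₄ {G} linear (edge 0F 2F) (edge 0F 3F) (edge 1F 2F) (edge 1F 3F) (distinct λ ()) (distinct λ ()) 0≡1)
    (no-bicolored-C₄ {G} linear (edge 0F 2F) (edge 0F 4F) (edge 1F 2F) (edge 1F 4F) (distinct λ ()) (distinct λ ()) 0≡1)
    (no-bicolored-C₄ {G} linear (edge 0F 3F) (edge 0F 4F) (edge 1F 3F) (edge 1F 4F) (distinct λ ()) (distinct λ ()) 0≡1)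
  bound (no 0≢1) with κ 2F Fin.≟ κ 3F
  ... | no 2≢3 = four-distinct⇒4≤ 0≢1 (apart 0F 2F) (apart 0F 3F) (apart 1F 2F) (apart 1F 3F) 2≢3
  -- As `2F` and `3F` share a color, `4F` must differ from them and supplies the fourth color.
  ... | yes 2≡3 = four-distinct⇒4≤ 0≢1 (apart 0F 2F) (apart 0F 4F) (apart 1F 2F) (apart 1F 4F)
    (no-monochromatic-triple {G} linear (edge 0F 2F) (edge 0F 3F) (edge 0F 4F)
      (distinct λ ()) (distinct λ ()) (distinct λ ()) 2≡3)

-- The graph K₂,₃

-- It suffices to treat induced subgraphs. Evaluating `anySubset?` shows that none of the 32 vertex
-- sets violates the bound, and decidability removes the double negation.
densityAtMost-K₂,₃ : DensityAtMost 12 5 K₂,₃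
densityAtMost-K₂,₃ H = ℕ.≤-trans (ℕ.*-monoʳ-≤ 5 (ℕ.*-monoʳ-≤ 2 (numEdges≤induced H)))
  (decidable-stable (bound? (V H)) λ ¬bound → toWitnessFalse {a? = anySubset? (¬? ∘ bound?)} _ (V H , ¬bound))
  where
  bound? : ∀ S → Dec (5 * (2 * numEdges (induced K₂,₃ S)) ≤ 12 * ∣ S ∣)
  bound? S = _ ℕ.≤? _

hasAverageDegree-K₂,₃ : HasAverageDegree K₂,₃ (+ 12 / 5)
-- The whole graph has 6 edges on 5 vertices.
hasAverageDegree-K₂,₃ = induced K₂,₃ ⊤ , _ , refl

-- Decidability of path decompositions and a linear coloring of `K₂,₃`

module _ {A : Set} (_≟_ : DecidableEquality A) where

  consecutive? : ∀ u v p → Dec (Consecutive {A} u v p)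
  consecutive? u v []          = no λ { ([] , _ , ()) ; (_ ∷ _ , _ , ()) }
  consecutive? u v (x ∷ [])    = no ¬consecutive-[x]
  consecutive? u v (x ∷ y ∷ p) = map′ ⇒ ⇐ ((x ≟ u ×-dec y ≟ v) ⊎-dec consecutive? u v (y ∷ p))
    where
    ⇒ : (x ≡ u × y ≡ v) ⊎ Consecutive u v (y ∷ p) → Consecutive u v (x ∷ y ∷ p)
    ⇒ (inj₁ (refl , refl))   = [] , p , refl
    ⇒ (inj₂ (xs , ys , eq)) = x ∷ xs , ys , cong (x ∷_) eq

    ⇐ : Consecutive u v (x ∷ y ∷ p) → (x ≡ u × y ≡ v) ⊎ Consecutive u v (y ∷ p)
    ⇐ ([]     , ys , refl) = inj₁ (refl , refl)
    ⇐ (_ ∷ xs , ys , eq)   = inj₂ (xs , ys , ∷-injectiveʳ eq)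

_⇔-dec_ : ∀ {A B : Set} → Dec A → Dec B → Dec (A ⇔ B)
a? ⇔-dec b? = map′ (λ (f , g) → mk⇔ f g) (λ e → to e , from e) ((a? →-dec b?) ×-dec (b? →-dec a?))

decomposes? : ∀ {G} (H : Subgraph G) pss → Dec (Decomposes H pss)
decomposes? H pss =
  unique? (concat pss) ×-dec
  Fin.all? (λ v → (v ∈? V H) ⇔-dec (v ∈ˡ? concat pss)) ×-dec
  Fin.all? (λ u → Fin.all? λ v → (E H u v Bool.≟ true) ⇔-dec
    Any.any? (λ p → consecutive? Fin._≟_ u v p ⊎-dec consecutive? Fin._≟_ v u p) pss)
  where
  open import Data.List.Relation.Unary.Unique.DecPropositional Fin._≟_ using (unique?)
  open import Data.List.Membership.DecPropositional Fin._≟_ using () renaming (_∈?_ to _∈ˡ?_)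

-- The small side shares one color and each vertex of the large side has a color of its own. That
-- the listed paths decompose every bicolored subgraph is decided by evaluation.
linearlyColorable-K₂,₃ : LinearlyColorable K₂,₃ 4
linearlyColorable-K₂,₃ = color , proper , λ a b a≢b → paths a b , toWitness {a? = linear?} _ a b a≢b
  where
  color : Vertex K₂,₃ → Fin 4
  color 0F            = 0F
  color 1F            = 0F
  color (suc (suc v)) = suc v

  proper : IsProper K₂,₃ color
  proper = toWitness {a? = Fin.all? λ u → Fin.all? λ v →
    (adj K₂,₃ u v Bool.≟ true) →-dec ¬? (color u Fin.≟ color v)} _

  -- Color `suc b` occurs at `suc (suc b)` only. With color `zero` it spans a path with ends `0F`
  -- and `1F`; two nonzero colors span two isolated vertices.
  paths : Fin 4 → Fin 4 → List (List⁺ (Vertex K₂,₃))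
  paths zero    zero    = []
  paths zero    (suc b) = [ 0F ∷ suc (suc b) ∷ 1F ∷ [] ]
  paths (suc a) zero    = [ 0F ∷ suc (suc a) ∷ 1F ∷ [] ]
  paths (suc a) (suc b) = (suc (suc a) ∷ []) ∷ (suc (suc b) ∷ []) ∷ []

  bicolored : Fin 4 → Fin 4 → Subgraph K₂,₃
  bicolored a b = induced K₂,₃ (colorClass color a ∪ colorClass color b)

  linear? : Dec (∀ a b → a ≢ b → Decomposes (bicolored a b) (map toList (paths a b)))
  linear? = Fin.all? λ a → Fin.all? λ b → ¬? (a Fin.≟ b) →-dec decomposes? (bicolored a b) (map toList (paths a b))

-- The infinite family

family : ℕ → Graph
family zero    = K₂,₃
family (suc i) = addIsolated (family i)

order-family : ∀ i → order (family i) ≡ i + 5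
order-family zero    = refl
order-family (suc i) = cong suc (order-family i)

≅⇒order≡ : ∀ {G H} → G ≅ H → order G ≡ order H
≅⇒order≡ G≅H = ↔⇒≡ (_≅_.bijection G≅H)

family-contains : ∀ i → family i ContainsSubgraph K₂,₃
family-contains zero    = id , id , λ _ _ → id
family-contains (suc i) = contains-addIsolated {family i} {K₂,₃} (family-contains i)

family-maxDegree : ∀ i → maxDegree (family i) ≡ 3
family-maxDegree zero    = refl
family-maxDegree (suc i) = trans (maxDegree-addIsolated (family i)) (family-maxDegree i)

family-dense : ∀ i → DensityAtMost 12 5 (family i)
family-dense zero    = densityAtMost-K₂,₃
family-dense (suc i) = densityAtMost-addIsolated {12} {5} (family-dense i)

family-averageDegree : ∀ i → HasAverageDegree (family i) (+ 12 / 5)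
family-averageDegree zero    = hasAverageDegree-K₂,₃
family-averageDegree (suc i) = hasAverageDegree-addIsolated (family-averageDegree i)

family-colorable : ∀ i → LinearlyColorable (family i) 4
family-colorable zero    = linearlyColorable-K₂,₃
family-colorable (suc i) = linearlyColorable-addIsolated (family-colorable i)

family-lc : ∀ i → IsLc (family i) (⌈ maxDegree (family i) /2⌉ + 2)
-- After the rewrite the value is `⌈ 3 /2⌉ + 2`, which computes to 4.
family-lc i rewrite family-maxDegree i = family-colorable i , λ j → contains-K₂,₃⇒4≤lc {family i} (family-contains i)

mainTheorem3 : Σ (ℕ → Graph) λ G →
    (∀ i j → i ≢ j → ¬ (G i ≅ G j)) ×
    (∀ i →
    (G i) ContainsSubgraph (completeBipartite 2 3) ×
    maxDegree (G i) ≤ 4 ×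
    IsMad (G i) (+ 12 / 5) ×
    IsLc (G i) (⌈ maxDegree (G i) /2⌉ + 2))
mainTheorem3 = family , non-isomorphic , λ i →
  family-contains i ,
  subst (_≤ 4) (sym (family-maxDegree i)) (ℕ.n≤1+n 3) ,
  isMad 12 5 (family-averageDegree i) (family-dense i) ,
  family-lc i
  where
  non-isomorphic : ∀ i j → i ≢ j → ¬ (family i ≅ family j)
  -- The members have pairwise different orders.
  non-isomorphic i j i≢j iso = i≢j (ℕ.+-cancelʳ-≡ 5 i j
    (trans (sym (order-family i)) (trans (≅⇒order≡ iso) (order-family j))))
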